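{- Let $\kappa$ be inaccessible and let $b:\kappa\to\kappa$ be an increasing function such that each $b(\alpha)$ is an infinite cardinal. For each regular cardinal $\lambda<\kappa$ let $D_\lambda=\{\alpha\in\kappa\mid\mathrm{cf}(b(\alpha))=\lambda\}$. (i) If there exists a least regular cardinal $\lambda<\kappa$ such that $D_\lambda$ is cofinal in $\kappa$, then $\mathfrak b_\kappa^b(\leq^*)=\lambda$. (ii) If $D_\lambda$ is bounded in $\kappa$ for all regular $\lambda<\kappa$ and there exists a stationary set $S\subseteq\kappa$ such that for each $\xi\in S$ there exists $\alpha_\xi\geq\xi$ with $\mathrm{cf}(b(\alpha_\xi))\leq\xi$, then $\mathfrak b_\kappa^b(\leq^*)=\kappa$. (iii) If $D_\lambda$ is bounded in $\kappa$ for all regular $\lambda<\kappa$ and there exists a club set $C\subseteq\kappa$ such that for each $\xi\in C$ we have $\mathrm{cf}(b(\alpha))>\xi$ for all $\alpha\geq\xi$, then $\mathfrak b_\kappa^b(\leq^*)\geq\kappa^+$.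
   Context: "Increasing" means not necessarily strictly increasing. $\prod b$ is the set of functions $f$ with domain $\kappa$ and $f(\alpha)\in b(\alpha)$ for all $\alpha\in\kappa$. $f\leq^*g$ means that there is $\beta<\kappa$ with $f(\alpha)\leq g(\alpha)$ for all $\alpha>\beta$. The unbounding number $\mathfrak b_\kappa^b(\leq^*)$ is the least size of a set $B\subseteq\prod b$ such that there is no $g\in\prod b$ with $f\leq^*g$ for all $f\in B$. -}

module Defs where

open import Data.Bool.Base using (Bool)
open import Data.Nat.Base using (ℕ)
open import Data.Product.Base using (∃; ∃-syntax; _×_; _,_)
open import Data.Refinement using (Refinement-syntax; value)
open import Function.Bundles using (_↣_; _⤖_)
open import Induction.WellFounded using (WellFounded)
open import Level using (Level; suc; _⊔_)
import Relation.Binary.Construct.On as On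
import Relation.Binary.Construct.StrictToNonStrict as StrictToNonStrict
open import Relation.Binary.Core using (Rel)
open import Relation.Binary.Definitions using (tri<; tri≈; tri>; Trichotomous)
open import Relation.Binary.PropositionalEquality
  using (_≡_; refl; cong; isEquivalence)
open import Relation.Binary.Structures using (IsStrictTotalOrder)
open import Relation.Nullary.Negation.Core using (¬_)
open import Relation.Unary using (Pred; _∩_; Satisfiable)

private
  variable
    a c p ℓ : Level

-- The definitions below are given their usual classical meaning by assuming
-- `ExcludedMiddle` and function extensionality at the point of use.  As Σ is
-- the strong sum, these also yield the axiom of choice.

------------------------------------------------------------------------
-- Ordinals

-- An ordinal is a well-ordered type.  The elements of (the carrier of) an
-- ordinal κ play the role of the ordinals α < κ; as an ordinal in its own
-- right, such an α is the initial segment κ ↓ α.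

record Ordinal ℓ : Set (suc ℓ) where
  infix 4 _<_
  field
    Carrier            : Set ℓ
    _<_                : Rel Carrier ℓ
    isStrictTotalOrder : IsStrictTotalOrder _≡_ _<_
    wellFounded        : WellFounded _<_

  open IsStrictTotalOrder isStrictTotalOrder public
    using (compare; irrefl; trans; asym)
  open StrictToNonStrict _≡_ _<_ public using (_≤_)

∣_∣ : Ordinal ℓ → Set ℓ
∣ κ ∣ = Ordinal.Carrier κ

-- Subsets are refinement types, whose membership proofs are irrelevant, so
-- that an element is counted once however many membership proofs it has.

Subset : {X : Set a} → Pred X p → Set (a ⊔ p)
Subset {X = X} A = [ x ∈ X ∣ A x ]

infix 8 _↓_

_↓_ : (κ : Ordinal ℓ) → ∣ κ ∣ → Ordinal ℓ
κ ↓ α = record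
  { Carrier            = Segment
  ; _<_                = _≺ˢ_
  ; isStrictTotalOrder = record
    { isStrictPartialOrder = record
      { isEquivalence = isEquivalence
      ; irrefl        = λ { refl → irrefl refl }
      ; trans         = trans
      ; <-resp-≈      = (λ { refl x<y → x<y }) , (λ { refl x<y → x<y })
      }
    ; compare = compareˢ
    }
  ; wellFounded = On.wellFounded value wellFounded
  }
  where
  open Ordinal κ

  Segment : Set _
  Segment = Subset (λ γ → γ < α)

  _≺ˢ_ : Rel Segment _
  x ≺ˢ y = value x < value y

  value-≡ : ∀ {x y : Segment} → value x ≡ value y → x ≡ y
  value-≡ refl = refl

  compareˢ : Trichotomous _≡_ _≺ˢ_
  compareˢ x y with compare (value x) (value y)
  ... | tri< x<y x≢y x≯y = tri< x<y (λ x≡y → x≢y (cong value x≡y)) x≯y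
  ... | tri≈ x≮y x≡y x≯y = tri≈ x≮y (value-≡ x≡y) x≯y
  ... | tri> x≮y x≢y x>y = tri> x≮y (λ x≡y → x≢y (cong value x≡y)) x>y

module _ (κ : Ordinal ℓ) where
  open Ordinal κ

  Cofinal : Pred ∣ κ ∣ p → Set (ℓ ⊔ p)
  Cofinal A = ∀ α → ∃[ γ ] A γ × α ≤ γ

  Bounded : Pred ∣ κ ∣ p → Set (ℓ ⊔ p)
  Bounded A = ∃[ β ] ∀ α → A α → α ≤ β

  IsLimit : Pred ∣ κ ∣ ℓ
  IsLimit δ = (∃[ α ] α < δ) × (∀ α → α < δ → ∃[ γ ] α < γ × γ < δ)

  IsClosed : Pred ∣ κ ∣ p → Set (ℓ ⊔ p)
  IsClosed C = ∀ δ → IsLimit δ →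
    (∀ α → α < δ → ∃[ γ ] C γ × α < γ × γ < δ) → C δ

  IsClub : Pred ∣ κ ∣ p → Set (ℓ ⊔ p)
  IsClub C = IsClosed C × Cofinal C

  IsStationary : Pred ∣ κ ∣ ℓ → Set (suc ℓ)
  IsStationary S = ∀ (C : Pred ∣ κ ∣ ℓ) → IsClub C → Satisfiable (S ∩ C)

------------------------------------------------------------------------
-- Cardinals

infix 4 _≼_ _≺_

_≼_ : Set a → Set c → Set (a ⊔ c)
A ≼ B = A ↣ B

_≺_ : Set a → Set c → Set (a ⊔ c)
A ≺ B = A ≼ B × ¬ (B ≼ A)

IsCardinal : Ordinal ℓ → Set ℓ
IsCardinal μ = ∀ α → ¬ (∣ μ ∣ ≼ ∣ μ ↓ α ∣)

IsInfiniteCardinal : Ordinal ℓ → Set ℓ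
IsInfiniteCardinal μ = IsCardinal μ × ℕ ≼ ∣ μ ∣

IsSuccessorCardinal : Ordinal ℓ → Ordinal ℓ → Set (suc ℓ)
IsSuccessorCardinal κ κ⁺ =
  IsCardinal κ⁺ × ∣ κ ∣ ≺ ∣ κ⁺ ∣ ×
  (∀ ν → IsCardinal ν → ∣ κ ∣ ≺ ∣ ν ∣ → ∣ κ⁺ ∣ ≼ ∣ ν ∣)

-- For a property P of subsets of X, `IsLeastSize P μ` says that μ is the
-- least size of a set with property P.

IsLeastSize : {X : Set ℓ} → Pred (Pred X ℓ) p → Ordinal ℓ → Set (suc ℓ ⊔ p)
IsLeastSize P μ =
  IsCardinal μ ×
  (∃[ A ] P A × Subset A ⤖ ∣ μ ∣) ×
  (∀ A → P A → ∣ μ ∣ ≼ Subset A)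

-- The least size of a set with property P is at least μ.  That some set has
-- property P is what makes this least size defined.

LeastSizeAtLeast : {X : Set ℓ} → Pred (Pred X ℓ) p → Ordinal ℓ → Set (suc ℓ ⊔ p)
LeastSizeAtLeast P μ = ∃ P × (∀ A → P A → ∣ μ ∣ ≼ Subset A)

-- cf(δ) = μ
IsCofinality : Ordinal ℓ → Ordinal ℓ → Set (suc ℓ)
IsCofinality δ μ = IsLeastSize (Cofinal δ) μ

IsRegular : Ordinal ℓ → Set (suc ℓ)
IsRegular μ = IsInfiniteCardinal μ × IsCofinality μ μ

IsInaccessible : Ordinal ℓ → Set (suc ℓ)
IsInaccessible κ =
  IsRegular κ × ℕ ≺ ∣ κ ∣ ×
  (∀ μ → IsCardinal (κ ↓ μ) → (∣ κ ↓ μ ∣ → Bool) ≺ ∣ κ ∣)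

------------------------------------------------------------------------
-- Bounded products of b : κ → κ

module _ (κ : Ordinal ℓ) (b : ∣ κ ∣ → ∣ κ ∣) where
  open Ordinal κ

  Increasing : Set ℓ
  Increasing = ∀ {α β} → α ≤ β → b α ≤ b β

  Cf-b : ∣ κ ∣ → Pred ∣ κ ∣ (suc ℓ)
  Cf-b α μ = IsCofinality (κ ↓ b α) (κ ↓ μ)

  D : ∣ κ ∣ → Pred ∣ κ ∣ (suc ℓ)
  D μ α = Cf-b α μ

  ∏b : Set ℓ
  ∏b = ∀ α → ∣ κ ↓ b α ∣

  infix 4 _≤*_

  _≤*_ : Rel ∏b ℓ
  f ≤* g = ∃[ β ] ∀ α → β < α → value (f α) ≤ value (g α)

  Unbounded : Pred (Pred ∏b ℓ) ℓ
  Unbounded B = ¬ (∃[ g ] ∀ f → B f → f ≤* g)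

  UnboundingNumberIs : Ordinal ℓ → Set (suc ℓ)
  UnboundingNumberIs = IsLeastSize Unbounded

  UnboundingNumberAtLeast : Ordinal ℓ → Set (suc ℓ)
  UnboundingNumberAtLeast = LeastSizeAtLeast Unbounded

{-# OPTIONS --safe #-}

-- Lower bounds: if, for almost all α, only |ξ(α)| < cf(b(α)) members of A have to
-- be dominated at α, then choosing g(α) above their values at α bounds A.  For
-- (i) and (ii) ξ is constant; for (iii) A is enumerated in type κ and
-- ξ(α) = sup (C ∩ [0,α]), which lies in C.
--
-- Upper bounds: let f_η(α) be the η-th term of a sequence cofinal in b(α) of
-- length cf(b(α)).  If g bounds all f_η, with f_η ≤ g beyond β_η, then some α
-- lies beyond β_η for all η < cf(b(α)), so g(α) bounds a cofinal sequence.  For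
-- (i) this α exists since κ is regular; for (ii) apply stationarity to the club
-- of points closed under η ↦ β_η.

module Submission where

open import Defs
open import Axiom.ExcludedMiddle using (ExcludedMiddle)
open import Axiom.Extensionality.Propositional using (Extensionality)
open import Data.Nat.Base as ℕ using (ℕ; zero; suc)
import Data.Nat.Properties as ℕ
open import Data.Product.Base using (∃; ∃-syntax; _×_; _,_; proj₁; proj₂)
open import Data.Irrelevant using ([_])
open import Data.Refinement using (_,_; value; value-injective)
open import Data.Sum.Base using (_⊎_; inj₁; inj₂; [_,_]′)
open import Data.Unit.Polymorphic.Base using (⊤; tt)
open import Function.Base using (_∘_)
open import Function.Bundles using (_↣_; _⤖_; mk↣; mk⤖; Injection; Bijection; Inverse)
open import Function.Construct.Composition using (_↣-∘_)
open import Function.Definitions using (Injective; Surjective)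
open import Function.Properties.Bijection using (⤖⇒↔)
open import Induction.WellFounded using (module All; module FixPoint; WfRec)
open import Level using (Level; _⊔_)
open import Relation.Binary.Definitions using (tri<; tri≈; tri>; Trans)
open import Relation.Binary.PropositionalEquality as ≡
  using (_≡_; _≢_; refl; sym; cong; subst)
import Relation.Binary.Construct.StrictToNonStrict as StrictToNonStrict
open import Relation.Nullary.Decidable using (Dec; yes; no; decidable-stable; recompute)
open import Relation.Nullary.Negation.Core using (¬_; contradiction)
open import Relation.Unary using (Pred)

private
  variable
    a c p q ℓ : Level
    A X : Set a
    B I : Set c

-- Classical logic and the Cantor-Bernstein theorem.

module Classical (em : ∀ {a} → ExcludedMiddle a)
                 (ext : ∀ {a b} → Extensionality a b) where

  byContradiction : ¬ ¬ A → A
  byContradiction = decidable-stable em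

  ¬∀⇒∃¬ : {P : Pred X p} → ¬ (∀ x → P x) → ∃[ x ] ¬ P x
  ¬∀⇒∃¬ ¬∀ = byContradiction λ ¬∃ → ¬∀ λ x → byContradiction λ ¬p → ¬∃ (x , ¬p)

  -- Membership proofs in `Subset` are irrelevant; `em` decides `P`, so `recompute` restores a
  -- usable one.
  member : {P : Pred X p} (x : Subset P) → P (value x)
  member (x , [ px ]) = recompute em px

  module _ {A : Set a} {B : Set c} (f : A → B) (g : B → A) where

    -- The iterates of `g ∘ f` starting outside the range of `g`. The bijection follows `f` on them
    -- and inverts `g` elsewhere, where preimages exist.
    data Chain : Pred A (a ⊔ c) where
      start : ∀ {x} → (∀ y → g y ≢ x) → Chain x
      next  : ∀ {x x′} → Chain x → g (f x) ≡ x′ → Chain x′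

  ≼-antisym : A ≼ B → B ≼ A → A ⤖ B
  ≼-antisym {A = A} {B = B} A≼B B≼A =
    mk⤖ ((λ {x} {y} → h-injective x em y em) , h-surjective)
    where
    open Injection A≼B using () renaming (to to f; injective to f-injective)
    open Injection B≼A using () renaming (to to g; injective to g-injective)

    preimage : ∀ {x} → ¬ Chain f g x → ∃[ y ] g y ≡ x
    preimage ¬c = byContradiction λ ¬∃ → ¬c (start λ y gy≡x → ¬∃ (y , gy≡x))

    -- The decision is an explicit argument so that matching on it makes `h` reduce; `em` is plugged
    -- in at the end.
    h : ∀ x → Dec (Chain f g x) → B
    h x (yes _) = f x
    h x (no ¬c) = proj₁ (preimage ¬c)

    h-injective : ∀ x d x′ d′ → h x d ≡ h x′ d′ → x ≡ x′
    h-injective x (yes c) x′ (yes c′) eq = f-injective eq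
    h-injective x (yes c) x′ (no ¬c′) eq =
      contradiction (next c (≡.trans (cong g eq) (proj₂ (preimage ¬c′)))) ¬c′
    h-injective x (no ¬c) x′ (yes c′) eq =
      contradiction (next c′ (≡.trans (cong g (sym eq)) (proj₂ (preimage ¬c)))) ¬c
    h-injective x (no ¬c) x′ (no ¬c′) eq =
      ≡.trans (sym (proj₂ (preimage ¬c))) (≡.trans (cong g eq) (proj₂ (preimage ¬c′)))

    h-chain : ∀ {x} d → Chain f g x → h x d ≡ f x
    h-chain (yes _) c = refl
    h-chain (no ¬c) c = contradiction c ¬c

    h-nonchain : ∀ {y} d → ¬ Chain f g (g y) → h (g y) d ≡ y
    h-nonchain (yes c) ¬c = contradiction c ¬c
    h-nonchain (no ¬c) _  = g-injective (proj₂ (preimage ¬c))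

    h-surjective : Surjective _≡_ _≡_ (λ x → h x em)
    h-surjective y with em {P = Chain f g (g y)}
    ... | yes (start gy≢)       = contradiction refl (gy≢ y)
    ... | yes (next {x} c gfx≡) =
      x , λ { refl → ≡.trans (h-chain em c) (g-injective gfx≡) }
    ... | no ¬c                 = g y , λ { refl → h-nonchain em ¬c }

  -- Injections between subsets.

  Subset-≼ : {P : Pred X p} → Subset P ≼ X
  Subset-≼ = mk↣ value-injective

  ≼-Subset : {P : Pred X p} (f : A → X) → (∀ x → P (f x)) →
             Injective _≡_ _≡_ f → A ≼ Subset P
  ≼-Subset f f∈P f-injective =
    mk↣ {to = λ x → f x , [ f∈P x ]} λ eq → f-injective (cong value eq)

  Subset-mono-≼ : {P : Pred X p} {Q : Pred X q} →
                  (∀ x → P x → Q x) → Subset P ≼ Subset Q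
  Subset-mono-≼ P⊆Q =
    ≼-Subset value (λ x → P⊆Q (value x) (member x)) value-injective

  covered⇒≼ : {P : Pred X p} (f : I → X) →
              (∀ x → P x → ∃[ i ] f i ≡ x) → Subset P ≼ I
  covered⇒≼ f cover = mk↣ {to = λ x → proj₁ (cover (value x) (member x))} λ {x} {y} eq →
    value-injective (≡.trans (sym (proj₂ (cover (value x) (member x))))
      (≡.trans (cong f eq) (proj₂ (cover (value y) (member y)))))

  -- Well-orders, initial segments and comparability of sizes.

  module Order (κ : Ordinal ℓ) where
    open Ordinal κ

    private
      module Strict = StrictToNonStrict _≡_ _<_

    <-≤-trans : Trans _<_ _≤_ _<_
    <-≤-trans = Strict.<-≤-trans trans λ { refl x<y → x<y }

    ≤-<-trans : Trans _≤_ _<_ _<_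
    ≤-<-trans = Strict.≤-<-trans sym trans λ { refl x<y → x<y }

    <⇒≱ : ∀ {x y} → x < y → ¬ (y ≤ x)
    <⇒≱ x<y y≤x = irrefl refl (<-≤-trans x<y y≤x)

    ≮∧≯⇒≡ : ∀ {x y} → ¬ (x < y) → ¬ (y < x) → x ≡ y
    ≮∧≯⇒≡ {x} {y} x≮y x≯y with compare x y
    ... | tri< x<y _ _ = contradiction x<y x≮y
    ... | tri≈ _ x≡y _ = x≡y
    ... | tri> _ _ x>y = contradiction x>y x≯y

    ≮⇒≥ : ∀ {x y} → ¬ (x < y) → y ≤ x
    ≮⇒≥ x≮y = byContradiction λ y≰x →
      y≰x (inj₂ (≮∧≯⇒≡ (y≰x ∘ inj₁) x≮y))

    ≰⇒> : ∀ {x y} → ¬ (x ≤ y) → y < x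
    ≰⇒> x≰y = byContradiction λ y≮x → x≰y (≮⇒≥ y≮x)

    least : (P : Pred ∣ κ ∣ p) → ∃ P → ∃[ x ] P x × (∀ y → P y → x ≤ y)
    least P (x , px) = All.wfRec wellFounded _
      (λ x → P x → ∃[ x ] P x × (∀ y → P y → x ≤ y)) go x px
      where
      go : ∀ x → (∀ {y} → y < x → P y → _) → P x → _
      go x rec px with em {P = ∃[ y ] y < x × P y}
      ... | yes (y , y<x , py) = rec y<x py
      ... | no ¬∃ = x , px , λ y py → ≮⇒≥ λ y<x → ¬∃ (y , y<x , py)

    max : ∀ x y → ∃[ z ] x ≤ z × y ≤ z
    max x y with compare x y
    ... | tri< x<y _ _ = y , inj₁ x<y , inj₂ refl
    ... | tri≈ _ x≡y _ = y , inj₂ x≡y , inj₂ refl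
    ... | tri> _ _ y<x = x , inj₂ refl , inj₁ y<x

  open Order using (<-≤-trans; ≤-<-trans; <⇒≱; ≮∧≯⇒≡; ≮⇒≥; ≰⇒>; least)

  NoMax : Ordinal ℓ → Set ℓ
  NoMax κ = ∀ α → ∃[ γ ] α < γ
    where open Ordinal κ

  ↓↓-≼ : (κ : Ordinal ℓ) {α : ∣ κ ∣} (β : ∣ κ ↓ α ∣) → ∣ (κ ↓ α) ↓ β ∣ ≼ ∣ κ ↓ value β ∣
  ↓↓-≼ κ β = ≼-Subset (λ γ → value (value γ)) member
    λ eq → value-injective (value-injective eq)

  ↓-≼-↓↓ : (κ : Ordinal ℓ) {α : ∣ κ ∣} (β : ∣ κ ↓ α ∣) → ∣ κ ↓ value β ∣ ≼ ∣ (κ ↓ α) ↓ β ∣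
  ↓-≼-↓↓ κ β = ≼-Subset (λ γ → value γ , [ Ordinal.trans κ (member γ) (member β) ]) member
    λ eq → value-injective (cong value eq)

  -- Enumerate A injectively along μ for as long as fresh elements are left.
  ≼-comparable : (μ : Ordinal ℓ) (A : Set a) → ∣ μ ∣ ≼ A ⊎ (∃[ ν ] A ≼ ∣ μ ↓ ν ∣)
  ≼-comparable μ A with em {P = ∃[ ν ] A ≼ ∣ μ ↓ ν ∣}
  ... | yes A≼ = inj₂ A≼
  ... | no ¬A≼ = inj₁ (mk↣ h-injective)
    where
    open Ordinal μ

    fresh : ∀ ν (f : ∣ μ ↓ ν ∣ → A) → ∃[ x ] ∀ y → f y ≢ x
    fresh ν f = byContradiction λ ¬fresh →
      let onto : ∀ x → ∃[ y ] f y ≡ x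
          onto x = byContradiction λ ¬∃ → ¬fresh (x , λ y eq → ¬∃ (y , eq))
      in ¬A≼ (ν , mk↣ {to = proj₁ ∘ onto} λ {x} {y} eq →
           ≡.trans (sym (proj₂ (onto x))) (≡.trans (cong f eq) (proj₂ (onto y))))

    step : ∀ x → WfRec _<_ (λ _ → A) x → A
    step x rec = proj₁ (fresh x λ y → rec (member y))

    h : ∣ μ ∣ → A
    h = All.wfRec wellFounded _ (λ _ → A) step

    h-fresh : ∀ x y → y < x → h y ≢ h x
    h-fresh x y y<x hy≡hx = proj₂ (fresh x (h ∘ value)) (_ , [ y<x ])
      (≡.trans hy≡hx
        -- Unfolding the recursion requires `step` to respect pointwise equality of earlier values;
        -- function extensionality provides this.
        (FixPoint.unfold-wfRec wellFounded (λ _ → A) step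
          λ x eq → cong (proj₁ ∘ fresh x) (ext λ y → eq (member y))))

    h-injective : Injective _≡_ _≡_ h
    h-injective {x} {y} hx≡hy =
      ≮∧≯⇒≡ μ (λ x<y → h-fresh y x x<y hx≡hy) (λ y<x → h-fresh x y y<x (sym hx≡hy))

  -- Infinite cardinals as limit ordinals.

  ℕ-≼-from : ℕ ≼ A → (x : A) → ∃[ f ] Injective {A = ℕ} _≡_ _≡_ f × f zero ≡ x
  ℕ-≼-from {A = A} ℕ≼A x with em {P = ∃[ n ] Injection.to ℕ≼A n ≡ x}
  ... | yes (k , fk≡x) =
    (λ n → f (k ℕ.+ n)) , (λ eq → ℕ.+-cancelˡ-≡ k _ _ (f-injective eq)) ,
    ≡.trans (cong f (ℕ.+-identityʳ k)) fk≡x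
    where open Injection ℕ≼A using () renaming (to to f; injective to f-injective)
  ... | no ¬∃ = f′ , f′-injective , refl
    where
    open Injection ℕ≼A using () renaming (to to f; injective to f-injective)

    f′ : ℕ → A
    f′ zero    = x
    f′ (suc n) = f n

    f′-injective : Injective _≡_ _≡_ f′
    f′-injective {zero}  {zero}  _  = refl
    f′-injective {zero}  {suc n} eq = contradiction (n , sym eq) ¬∃
    f′-injective {suc m} {zero}  eq = contradiction (m , eq) ¬∃
    f′-injective {suc m} {suc n} eq = cong suc (f-injective eq)

  -- Hilbert's hotel: shift along a sequence that starts at `x` and fix everything off it.
  infinite⇒≼-remove : ℕ ≼ A → (x : A) → A ≼ Subset (_≢ x)
  infinite⇒≼-remove {A = A} ℕ≼A x with ℕ-≼-from ℕ≼A x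
  ... | f , f-injective , refl =
    ≼-Subset (λ y → h y em) (λ y → h-avoids y em) λ {y} {y′} → h-injective y em y′ em
    where
    InRange : Pred A _
    InRange y = ∃[ n ] f n ≡ y

    h : ∀ y → Dec (InRange y) → A
    h y (yes (n , _)) = f (suc n)
    h y (no _)        = y

    h-avoids : ∀ y d → h y d ≢ f zero
    h-avoids y (yes _) eq with () ← f-injective eq
    h-avoids y (no ¬r) eq = ¬r (zero , sym eq)

    h-injective : ∀ y d y′ d′ → h y d ≡ h y′ d′ → y ≡ y′
    h-injective y (yes (n , refl)) y′ (yes (n′ , refl)) eq =
      cong f (ℕ.suc-injective (f-injective eq))
    h-injective y (yes (n , _)) y′ (no ¬r) eq = contradiction (suc n , eq) ¬r
    h-injective y (no ¬r) y′ (yes (n , _)) eq = contradiction (suc n , sym eq) ¬r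
    h-injective y (no _) y′ (no _) eq = eq

  -- If `α` were last, `μ` minus a point would be the segment below `α`, yet removing a point does
  -- not shrink an infinite set.
  infiniteCardinal⇒NoMax : (μ : Ordinal ℓ) → IsInfiniteCardinal μ → NoMax μ
  infiniteCardinal⇒NoMax μ (cardinal , infinite) α = byContradiction λ α-max →
    cardinal α (Subset-mono-≼
      (λ x x≢α → ≢⇒< α-max x≢α) ↣-∘ infinite⇒≼-remove infinite α)
    where
    open Ordinal μ

    ≢⇒< : ¬ (∃[ γ ] α < γ) → ∀ {x} → x ≢ α → x < α
    ≢⇒< α-max x≢α = byContradiction λ x≮α →
      x≢α (≮∧≯⇒≡ μ x≮α λ α<x → α-max (_ , α<x))

  module _ (κ : Ordinal ℓ) (f : ℕ → ∣ κ ∣)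
           (f-step : ∀ n → Ordinal._<_ κ (f n) (f (suc n))) where
    open Ordinal κ

    sequence-mono : ∀ {m n} → m ℕ.<′ n → f m < f n
    sequence-mono ℕ.<′-base       = f-step _
    sequence-mono (ℕ.<′-step m<n) = trans (sequence-mono m<n) (f-step _)

    sequence-injective : Injective _≡_ _≡_ f
    sequence-injective {m} {n} eq with ℕ.<-cmp m n
    ... | tri< m<n _ _ = contradiction (sequence-mono (ℕ.<⇒<′ m<n)) (irrefl eq)
    ... | tri≈ _ m≡n _ = m≡n
    ... | tri> _ _ n<m = contradiction (sequence-mono (ℕ.<⇒<′ n<m)) (irrefl (sym eq))

  NoMax⇒infinite : (κ : Ordinal ℓ) → NoMax κ → ∣ κ ∣ → ℕ ≼ ∣ κ ∣
  NoMax⇒infinite κ noMax x = mk↣ (sequence-injective κ f λ n → proj₂ (noMax (f n)))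
    where
    f : ℕ → ∣ κ ∣
    f zero    = x
    f (suc n) = proj₁ (noMax (f n))

  ↓-cardinal : (κ : Ordinal ℓ) (let open Ordinal κ) → ∀ {μ ξ} → IsCardinal (κ ↓ μ) →
               ξ < μ → ¬ (∣ κ ↓ μ ∣ ≼ ∣ κ ↓ ξ ∣)
  ↓-cardinal κ cardinal ξ<μ ≼ξ = cardinal (_ , [ ξ<μ ]) (↓-≼-↓↓ κ (_ , [ ξ<μ ]) ↣-∘ ≼ξ)

  -- Cofinality and regularity.

  ¬Cofinal⇒bounded : (δ : Ordinal ℓ) (let open Ordinal δ) {P : Pred ∣ δ ∣ p} →
                     ¬ Cofinal δ P → ∃[ β ] ∀ x → P x → x < β
  ¬Cofinal⇒bounded δ ¬cofinal with ¬∀⇒∃¬ ¬cofinal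
  ... | β , ¬∃ = β , λ x px → ≰⇒> δ λ β≤x → ¬∃ (x , px , β≤x)

  module _ (δ μ : Ordinal ℓ) (cf : IsCofinality δ μ) where
    private
      module μ = Ordinal μ
    open Ordinal δ

    small⇒bounded : (P : Pred ∣ δ ∣ ℓ) → ¬ (∣ μ ∣ ≼ Subset P) →
                    ∃[ β ] ∀ x → P x → x < β
    small⇒bounded P small =
      ¬Cofinal⇒bounded δ (λ cofinal → small (proj₂ (proj₂ cf) P cofinal))

    small-family⇒bounded : {I : Set ℓ} → ¬ (∣ μ ∣ ≼ I) → (f : I → ∣ δ ∣) →
                           ∃[ β ] ∀ i → f i < β
    small-family⇒bounded small f
      with small⇒bounded (λ x → ∃[ i ] f i ≡ x)
             (λ μ≼ → small (covered⇒≼ f (λ _ x∈ → x∈) ↣-∘ μ≼))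
    ... | β , <β = β , λ i → <β (f i) (i , refl)

    cofinal-sequence : ∃[ e ] ∀ α → ∃[ η ] α ≤ e η
    cofinal-sequence with proj₁ (proj₂ cf)
    ... | A , cofinal , A⤖μ = value ∘ from , λ α →
      let γ , γ∈A , α≤γ = cofinal α
      in to (γ , [ γ∈A ]) , subst (α ≤_) (sym (cong value (strictlyInverseʳ (γ , [ γ∈A ])))) α≤γ
      where open Inverse (⤖⇒↔ A⤖μ)

    -- If e is cofinal in δ of length μ, and s ξ bounds {e η ∣ η < ξ}, then s maps
    -- cofinal subsets of μ to cofinal subsets of δ.
    cofinality-regular : NoMax δ → ∣ δ ∣ → IsRegular μ
    cofinality-regular noMax x =
      (cardinal , NoMax⇒infinite μ μ-noMax (proj₁ (e-cofinal x))) ,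
      cardinal ,
      ((λ _ → ⊤) , (λ α → α , tt , inj₂ refl) ,
       ≼-antisym Subset-≼ (≼-Subset (λ α → α) (λ _ → tt) (λ eq → eq))) ,
      λ A A-cofinal → covered⇒≼ (s ∘ value)
        (λ { γ (ξ , ξ∈A , eq) → (ξ , [ ξ∈A ]) , eq })
        ↣-∘ proj₂ (proj₂ cf) (λ γ → ∃[ ξ ] A ξ × s ξ ≡ γ) λ α →
          let η , α≤eη = e-cofinal α
              -- `s ξ` bounds `e` only strictly before `ξ`, so `ξ` must be sought beyond `η`.
              ζ , η<ζ = μ-noMax η
              ξ , ξ∈A , ζ≤ξ = A-cofinal ζ
          in s ξ , (ξ , ξ∈A , refl) ,
             inj₁ (≤-<-trans δ α≤eη (e<s (<-≤-trans μ η<ζ ζ≤ξ)))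
      where
      cardinal = proj₁ cf
      e = proj₁ cofinal-sequence
      e-cofinal = proj₂ cofinal-sequence

      initial-bounded : ∀ ξ → ∃[ β ] ∀ (η : ∣ μ ↓ ξ ∣) → e (value η) < β
      initial-bounded ξ = small-family⇒bounded (cardinal ξ) (e ∘ value)

      s : ∣ μ ∣ → ∣ δ ∣
      s = proj₁ ∘ initial-bounded

      e<s : ∀ {η ξ} → η μ.< ξ → e η < s ξ
      e<s {η} {ξ} η<ξ = proj₂ (initial-bounded ξ) (η , [ η<ξ ])

      -- If `η` were last, the larger of `s η` and `e η` would bound all of `e`, although `e` is
      -- cofinal and `δ` has no last element.
      μ-noMax : NoMax μ
      μ-noMax η = byContradiction λ η-max →
        let y , s≤y , eη≤y = Order.max δ (s η) (e η)
            z , y<z = noMax y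
            ζ , z≤eζ = e-cofinal z
            ζ≤η = ≮⇒≥ μ λ η<ζ → η-max (ζ , η<ζ)
        in <⇒≱ δ (<-≤-trans δ y<z z≤eζ) (e≤ s≤y eη≤y ζ≤η)
        where
        e≤ : ∀ {y ζ} → s η ≤ y → e η ≤ y → ζ μ.≤ η → e ζ ≤ y
        e≤ s≤y eη≤y (inj₁ ζ<η)  = inj₁ (<-≤-trans δ (e<s ζ<η) s≤y)
        e≤ s≤y eη≤y (inj₂ refl) = eη≤y

  -- Take the least `ν` whose segment receives an injection from a cofinal set; `β` itself qualifies
  -- through the full set. Leastness, as `too-small`, makes the segment a cardinal and, with
  -- comparability, minimal.
  cofinality : (κ : Ordinal ℓ) (β : ∣ κ ∣) → ∃[ ν ] IsCofinality (κ ↓ β) (κ ↓ ν)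
  cofinality {ℓ} κ β with least κ
    (λ ν → ∃[ A ] Cofinal (κ ↓ β) {p = ℓ} A × Subset A ≼ ∣ κ ↓ ν ∣)
    (β , (λ _ → ⊤) , (λ α → α , tt , inj₂ refl) , Subset-≼)
  ... | ν , (A , A-cofinal , A≼ν) , ν-least =
    ν , cardinal , (A , A-cofinal , ≼-antisym A≼ν (minimal A A-cofinal)) , minimal
    where
    too-small : ∀ A → Cofinal (κ ↓ β) A → (ρ : ∣ κ ↓ ν ∣) → ¬ (Subset A ≼ ∣ (κ ↓ ν) ↓ ρ ∣)
    too-small A A-cofinal ρ A≼ρ =
      <⇒≱ κ (member ρ) (ν-least (value ρ) (A , A-cofinal , (↓↓-≼ κ ρ ↣-∘ A≼ρ)))

    cardinal : IsCardinal (κ ↓ ν)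
    cardinal ρ ν≼ρ = too-small A A-cofinal ρ (ν≼ρ ↣-∘ A≼ν)

    minimal : ∀ A → Cofinal (κ ↓ β) A → ∣ κ ↓ ν ∣ ≼ Subset A
    minimal A A-cofinal with ≼-comparable (κ ↓ ν) (Subset A)
    ... | inj₁ ν≼A       = ν≼A
    ... | inj₂ (ρ , A≼ρ) = contradiction A≼ρ (too-small A A-cofinal ρ)

  cofinality-unique : (κ : Ordinal ℓ) {β μ ν : ∣ κ ∣} →
    IsCofinality (κ ↓ β) (κ ↓ μ) → IsCofinality (κ ↓ β) (κ ↓ ν) → μ ≡ ν
  cofinality-unique κ {β} cfμ cfν = ≮∧≯⇒≡ κ (≮ cfμ cfν) (≮ cfν cfμ)
    where
    open Ordinal κ

    ≮ : ∀ {μ ν} → IsCofinality (κ ↓ β) (κ ↓ μ) → IsCofinality (κ ↓ β) (κ ↓ ν) → ¬ (μ < ν)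
    ≮ (_ , (A , A-cofinal , A⤖μ) , _) (ν-cardinal , _ , ν-minimal) μ<ν =
      ↓-cardinal κ ν-cardinal μ<ν (mk↣ (Bijection.injective A⤖μ) ↣-∘ ν-minimal A A-cofinal)

  -- Hilbert's choice operator; its value is the default x if P is empty.
  ε : Pred X p → X → X
  ε P x with em {P = ∃ P}
  ... | yes (y , _) = y
  ... | no _        = x

  ε-∈ : (P : Pred X p) (x : X) → ∃ P → P (ε P x)
  ε-∈ P x ∃P with em {P = ∃ P}
  ... | yes (_ , py) = py
  ... | no ¬∃P       = contradiction ∃P ¬∃P

  -- Domination in the product and lower bounds.

  module BoundedProduct (κ : Ordinal ℓ) (κ-regular : IsRegular κ) (κ-uncountable : ℕ ≺ ∣ κ ∣)
                 (b : ∣ κ ∣ → ∣ κ ∣)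
                 (b-infinite : ∀ α → IsInfiniteCardinal (κ ↓ b α)) where
    open Ordinal κ

    κ-cardinal : IsCardinal κ
    κ-cardinal = proj₁ (proj₁ κ-regular)

    κ-noMax : NoMax κ
    κ-noMax = infiniteCardinal⇒NoMax κ (proj₁ κ-regular)

    family-bounded : {I : Set ℓ} → ¬ (∣ κ ∣ ≼ I) → (f : I → ∣ κ ∣) → ∃[ β ] ∀ i → f i < β
    family-bounded = small-family⇒bounded κ κ (proj₂ κ-regular)

    point : ∀ α → ∣ κ ↓ b α ∣
    point α = Injection.to (proj₂ (b-infinite α)) zero

    b-noMax : ∀ α → NoMax (κ ↓ b α)
    b-noMax α = infiniteCardinal⇒NoMax (κ ↓ b α) (b-infinite α)

    cf : ∣ κ ∣ → ∣ κ ∣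
    cf α = proj₁ (cofinality κ (b α))

    cf-b : ∀ α → Cf-b κ b α (cf α)
    cf-b α = proj₂ (cofinality κ (b α))

    cf-b≡ : ∀ {α μ} → Cf-b κ b α μ → cf α ≡ μ
    cf-b≡ {α} = cofinality-unique κ (cf-b α)

    dominated : (A : Pred (∏b κ b) ℓ) (rank : Subset A ↣ ∣ κ ∣) →
                (let open Injection rank using (to)) →
                (ξ : ∣ κ ∣ → ∣ κ ∣) →
                (∀ f → ∃[ β ] ∀ α → β < α → to f < ξ α × ξ α < cf α) →
                ¬ Unbounded κ b A
    dominated A rank ξ eventually unbounded = unbounded (g , λ f f∈A →
      let β , β-bound = eventually (f , [ f∈A ])
      in β , λ α β<α → let f<ξ , ξ<cf = β-bound α β<α in
         inj₁ (ε-∈ (Bound α) (point α) (bound α ξ<cf) (f , [ f∈A ]) f<ξ))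
      where
      open Injection rank using () renaming (to to rk; injective to rk-injective)

      Bound : ∀ α → Pred ∣ κ ↓ b α ∣ ℓ
      Bound α x = ∀ f → rk f < ξ α → value (value f α) < value x

      g : ∏b κ b
      -- The default is taken only where `ξ α < cf α` fails; `eventually` confines such coordinates
      -- below the threshold of each `f`.
      g α = ε (Bound α) (point α)

      bound : ∀ α → ξ α < cf α → ∃ (Bound α)
      bound α ξ<cf with small-family⇒bounded (κ ↓ b α) (κ ↓ cf α) (cf-b α)
        {I = Subset (λ f → rk f < ξ α)}
        (λ cf≼ → ↓-cardinal κ (proj₁ (cf-b α)) ξ<cf
          (≼-Subset (rk ∘ value) member (value-injective ∘ rk-injective) ↣-∘ cf≼))
        (λ f → value (value f) α)
      ... | x , <x = x , λ f f<ξ → <x (f , [ f<ξ ])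

    -- Cofinalities are regular, so a coordinate with `cf α ≤ ν` lies in one of the bounded sets
    -- `D κ b λ′` with `λ′ ≤ ν`. There are fewer than `κ` of these, and regularity of `κ` yields a
    -- common bound.
    cf-eventually-above : ∀ ν →
      (∀ λ′ → IsRegular (κ ↓ λ′) → λ′ ≤ ν → Bounded κ (D κ b λ′)) →
      ∃[ β ] ∀ α → β < α → ν < cf α
    cf-eventually-above ν D-bounded = β , λ α β<α → byContradiction λ ν≮cf →
      let cf≤ν = ≮⇒≥ κ ν≮cf
          cf-regular = cofinality-regular (κ ↓ b α) (κ ↓ cf α) (cf-b α) (b-noMax α) (point α)
          α≤d = ε-∈ (Bound (cf α)) ν (D-bounded (cf α) cf-regular cf≤ν) α (cf-b α)
      in <⇒≱ κ β<α (inj₁ (≤-<-trans κ α≤d (d<β (cf α , [ cf≤ν ]))))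
      where
      Bound : ∣ κ ∣ → Pred ∣ κ ∣ _
      Bound λ′ β = ∀ α → D κ b λ′ α → α ≤ β

      small : ¬ (∣ κ ∣ ≼ Subset (_≤ ν))
      small κ≼ = let ν′ , ν<ν′ = κ-noMax ν in
        κ-cardinal ν′ (Subset-mono-≼ (λ _ x≤ν → ≤-<-trans κ x≤ν ν<ν′) ↣-∘ κ≼)

      -- A `λ′` without a bound gets the default `ν`. This is harmless: `cf α` is regular, so it has
      -- a genuine bound when `cf α ≤ ν`.
      d-bounded : ∃[ β ] ∀ (λ′ : Subset (_≤ ν)) → ε (Bound (value λ′)) ν < β
      d-bounded = family-bounded small (λ λ′ → ε (Bound (value λ′)) ν)

      β = proj₁ d-bounded
      d<β = proj₂ d-bounded

    -- With `ξ` constantly `ν`, all of `A` is dominated at once wherever `ν < cf α`. Boundedness is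
    -- asked only for `λ′ ≤ ν` because (i) has it only below the least cofinal `λ`.
    small⇒¬unbounded : ∀ ν →
      (∀ λ′ → IsRegular (κ ↓ λ′) → λ′ ≤ ν → Bounded κ (D κ b λ′)) →
      (A : Pred (∏b κ b) ℓ) → Subset A ≼ ∣ κ ↓ ν ∣ → ¬ Unbounded κ b A
    small⇒¬unbounded ν D-bounded A A≼ν =
      let β , ν<cf = cf-eventually-above ν D-bounded
      in dominated A (Subset-≼ ↣-∘ A≼ν) (λ _ → ν) λ f →
           β , λ α β<α → member (Injection.to A≼ν f) , ν<cf α β<α

    -- The diagonal family and the upper bound in (i).

    sequence : ∀ α → ∣ κ ↓ cf α ∣ → ∣ κ ↓ b α ∣
    sequence α = proj₁ (cofinal-sequence (κ ↓ b α) (κ ↓ cf α) (cf-b α))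

    -- The functions `f_η` of the upper bounds. For `η` at or beyond `cf α` there is no `η`-th term,
    -- hence the default.
    diagonal : ∣ κ ∣ → ∏b κ b
    diagonal η α with em {P = η < cf α}
    ... | yes η<cf = sequence α (η , [ η<cf ])
    ... | no _     = point α

    diagonal-sequence : ∀ {α} (η : ∣ κ ↓ cf α ∣) → diagonal (value η) α ≡ sequence α η
    diagonal-sequence {α} η with em {P = value η < cf α}
    ... | yes _    = refl
    ... | no η≮cf  = contradiction (member η) η≮cf

    diagonal-unbounded : ∀ {α μ} → Cf-b κ b α μ → (x : ∣ κ ↓ b α ∣) →
      ¬ (∀ η → η < μ → value (diagonal η α) ≤ value x)
    diagonal-unbounded {α} α∈D x ≤x with refl ← cf-b≡ α∈D =
      -- The sequence only reaches `y` weakly, so `y` is taken strictly above `x`.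
      let y , x<y = b-noMax α x
          η , y≤ = proj₂ (cofinal-sequence (κ ↓ b α) (κ ↓ cf α) (cf-b α)) y
          x<η = <-≤-trans (κ ↓ b α) {x} {y} {sequence α η} x<y y≤
      in <⇒≱ κ x<η (subst (λ z → value z ≤ value x) (diagonal-sequence η)
           (≤x (value η) (member η)))

    Range : {I : Set ℓ} → (I → ∏b κ b) → Pred (∏b κ b) ℓ
    Range F f = ∃[ i ] F i ≡ f

    -- `F` may repeat values: its range has size at most `μ` by choosing indices, and at least `μ`
    -- by minimality applied to the range itself.
    unbounding-number : (μ : Ordinal ℓ) → IsCardinal μ → (F : ∣ μ ∣ → ∏b κ b) →
      Unbounded κ b (Range F) →
      (∀ A → Unbounded κ b A → ∀ ν → ¬ (Subset A ≼ ∣ μ ↓ ν ∣)) →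
      UnboundingNumberIs κ b μ
    unbounding-number μ cardinal F F-unbounded small =
      cardinal ,
      (Range F , F-unbounded ,
       ≼-antisym (covered⇒≼ F λ _ f∈ → f∈) (minimal (Range F) F-unbounded)) ,
      minimal
      where
      minimal : ∀ A → Unbounded κ b A → ∣ μ ∣ ≼ Subset A
      minimal A A-unbounded with ≼-comparable μ (Subset A)
      ... | inj₁ μ≼A       = μ≼A
      ... | inj₂ (ν , A≼ν) = contradiction A≼ν (small A A-unbounded ν)

    least-cofinal-D : ∀ μ → IsRegular (κ ↓ μ) → Cofinal κ (D κ b μ) →
      (∀ ν → IsRegular (κ ↓ ν) → Cofinal κ (D κ b ν) → μ ≤ ν) →
      UnboundingNumberIs κ b (κ ↓ μ)
    least-cofinal-D μ μ-regular D-cofinal μ-least =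
      unbounding-number (κ ↓ μ) (proj₁ (proj₁ μ-regular)) (diagonal ∘ value)
        (λ { (g , g-bound) →
          let bounds = λ η → g-bound (diagonal (value η)) (η , refl)
              -- The thresholds are indexed by `κ ↓ μ`, too small to be cofinal in the regular `κ`.
              β , <β = family-bounded (κ-cardinal μ) (proj₁ ∘ bounds)
              γ , γ∈D , β≤γ = D-cofinal β
          in diagonal-unbounded γ∈D (g γ) λ η η<μ →
               proj₂ (bounds (η , [ η<μ ])) γ (<-≤-trans κ (<β (η , [ η<μ ])) β≤γ) })
        λ A A-unbounded ρ A≼ρ → small⇒¬unbounded (value ρ)
          (λ λ′ λ′-regular λ′≤ρ →
            let β , <β = ¬Cofinal⇒bounded κ λ D-cofinal →
                  <⇒≱ κ (≤-<-trans κ λ′≤ρ (member ρ)) (μ-least λ′ λ′-regular D-cofinal)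
            in β , λ α α∈D → inj₁ (<β α α∈D))
          A (↓↓-≼ κ ρ ↣-∘ A≼ρ) A-unbounded

    -- Closure points and the stationary case (ii).

    closure-points-club : (β : ∣ κ ∣ → ∣ κ ∣) → IsClub κ (λ ξ → ∀ η → η < ξ → β η < ξ)
    closure-points-club β = closed , unbounded
      where
      closed : IsClosed κ (λ ξ → ∀ η → η < ξ → β η < ξ)
      closed δ _ δ-limit η η<δ =
        let γ , γ-closed , η<γ , γ<δ = δ-limit η η<δ
        in trans (γ-closed η η<γ) γ<δ

      above : ∀ x → ∃[ y ] x < y × (∀ η → η < x → β η < y)
      above x =
        let u , β<u = family-bounded (κ-cardinal x) (β ∘ value)
            v , x<v = κ-noMax x
            y , u≤y , v≤y = Order.max κ u v
        in y , <-≤-trans κ x<v v≤y , λ η η<x → <-≤-trans κ (β<u (η , [ η<x ])) u≤y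

      module _ (α : ∣ κ ∣) where
        u : ℕ → ∣ κ ∣
        u zero    = α
        u (suc n) = proj₁ (above (u n))

        u-step : ∀ n → u n < u (suc n)
        u-step n = proj₁ (proj₂ (above (u n)))

        u-bounded : ∃[ δ ] ∀ x → (∃[ n ] u n ≡ x) → x < δ
        u-bounded = small⇒bounded κ κ (proj₂ κ-regular) (λ x → ∃[ n ] u n ≡ x)
          λ κ≼ → proj₂ κ-uncountable (covered⇒≼ u (λ _ x∈ → x∈) ↣-∘ κ≼)

        u-sup : ∃[ δ ] (∀ n → u n < δ) × (∀ ζ → (∀ n → u n < ζ) → δ ≤ ζ)
        u-sup = least κ (λ δ → ∀ n → u n < δ)
          (proj₁ u-bounded , λ n → proj₂ u-bounded (u n) (n , refl))

      unbounded : Cofinal κ (λ ξ → ∀ η → η < ξ → β η < ξ)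
      unbounded α =
        let δ , u<δ , δ-least = u-sup α
        in δ , (λ η η<δ →
             -- `δ` is the least strict bound of the `u n`, so `η` is not one and `η ≤ u n` for some
             -- `n`. One step makes this strict, and a second captures `β η`.
             let n , u≮η = ¬∀⇒∃¬ λ u<η → <⇒≱ κ η<δ (δ-least η u<η)
                 η<u = ≤-<-trans κ (≮⇒≥ κ u≮η) (u-step α n)
             in trans (proj₂ (proj₂ (above (u α (suc n)))) η η<u) (u<δ (suc (suc n)))) ,
           inj₁ (u<δ zero)

    stationary-small-cf : (∀ μ → IsRegular (κ ↓ μ) → Bounded κ (D κ b μ)) →
      (∃[ S ] IsStationary κ S ×
        (∀ ξ → S ξ → ∃[ α ] ξ ≤ α × (∃[ μ ] Cf-b κ b α μ × μ ≤ ξ))) →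
      UnboundingNumberIs κ b κ
    stationary-small-cf D-bounded (S , S-stationary , S-small) =
      unbounding-number κ κ-cardinal diagonal
        (λ { (g , g-bound) →
          let bounds = λ η → g-bound (diagonal η) (η , refl)
              ξ , ξ∈S , ξ-closed = S-stationary _ (closure-points-club (proj₁ ∘ bounds))
              α , ξ≤α , μ , α∈D , μ≤ξ = S-small ξ ξ∈S
          -- For `η < μ ≤ ξ` the threshold lies below `ξ ≤ α`, so all these `η` are dominated at the
          -- single coordinate `α`.
          in diagonal-unbounded α∈D (g α) λ η η<μ →
               proj₂ (bounds η) α
                 (<-≤-trans κ (ξ-closed η (<-≤-trans κ η<μ μ≤ξ)) ξ≤α) })
        λ A A-unbounded ν A≼ν →
          small⇒¬unbounded ν (λ μ μ-regular _ → D-bounded μ μ-regular) A A≼ν A-unbounded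

    -- Moving strictly above `g` at each coordinate escapes it. This supplies the unbounded set that
    -- `LeastSizeAtLeast` demands.
    everything-unbounded : Unbounded κ b (λ _ → ⊤)
    everything-unbounded (g , g-bound) =
      let β , ≤g = g-bound (λ α → proj₁ (b-noMax α (g α))) tt
          α , β<α = κ-noMax β
      in <⇒≱ κ (proj₂ (b-noMax α (g α))) (≤g α β<α)

    -- Suprema along a club and the case (iii).

    module _ (C : Pred ∣ κ ∣ ℓ) (C-club : IsClub κ C) where

      club-sup : ∀ α → ∃[ σ ] (∀ ξ → C ξ → ξ ≤ α → ξ ≤ σ) ×
                              (∀ ζ → (∀ ξ → C ξ → ξ ≤ α → ξ ≤ ζ) → σ ≤ ζ)
      club-sup α = least κ _ (α , λ _ _ ξ≤α → ξ≤α)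

      club-floor : ∣ κ ∣ → ∣ κ ∣
      club-floor α = proj₁ (club-sup α)

      club-floor-upper : ∀ {α ξ} → C ξ → ξ ≤ α → ξ ≤ club-floor α
      club-floor-upper ξ∈C ξ≤α = proj₁ (proj₂ (club-sup _)) _ ξ∈C ξ≤α

      club-floor-≤ : ∀ α → club-floor α ≤ α
      club-floor-≤ α = proj₂ (proj₂ (club-sup α)) α λ _ _ ξ≤α → ξ≤α

      -- Otherwise the supremum would be a limit of C.
      club-floor-∈ : ∀ {α ξ} → C ξ → ξ ≤ α → C (club-floor α)
      club-floor-∈ {α} {ξ} ξ∈C ξ≤α = byContradiction λ σ∉C →
        let ≢σ : ∀ {ζ} → C ζ → ζ ≡ club-floor α → _
            ≢σ ζ∈C eq = σ∉C (subst C eq ζ∈C)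
            <σ : ∀ {ζ} → C ζ → ζ ≤ α → ζ < club-floor α
            <σ ζ∈C ζ≤α = [ (λ ζ<σ → ζ<σ) , (λ eq → contradiction eq (≢σ ζ∈C)) ]′
              (club-floor-upper ζ∈C ζ≤α)
            dense : ∀ x → x < club-floor α → ∃[ γ ] C γ × x < γ × γ < club-floor α
            dense x x<σ = byContradiction λ ¬∃ → <⇒≱ κ x<σ
              (proj₂ (proj₂ (club-sup α)) x λ ζ ζ∈C ζ≤α →
                ≮⇒≥ κ λ x<ζ → ¬∃ (ζ , ζ∈C , x<ζ , <σ ζ∈C ζ≤α))
        in σ∉C (proj₁ C-club (club-floor α)
             ((ξ , <σ ξ∈C ξ≤α) , λ x x<σ → let γ , _ , x<γ , γ<σ = dense x x<σ in γ , x<γ , γ<σ)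
             dense)

    club-large-cf : (∃[ C ] IsClub κ {ℓ} C ×
        (∀ ξ → C ξ → ∀ α → ξ ≤ α → ∃[ μ ] Cf-b κ b α μ × ξ < μ)) →
      (A : Pred (∏b κ b) ℓ) → Subset A ≼ ∣ κ ∣ → ¬ Unbounded κ b A
    club-large-cf (C , C-club , C-large) A rank = dominated A rank (club-floor C C-club) λ f →
      -- Past a point `ξ` of `C` above the rank of `f`, the floor stays above that rank and lies in
      -- `C`, so `C-large` applies to it.
      let ζ , f<ζ = κ-noMax (Injection.to rank f)
          ξ , ξ∈C , ζ≤ξ = proj₂ C-club ζ
      in ξ , λ α ξ<α →
           let σ∈C = club-floor-∈ C C-club ξ∈C (inj₁ ξ<α)
               μ , α∈D , σ<μ = C-large _ σ∈C α (club-floor-≤ C C-club α)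
           in <-≤-trans κ (<-≤-trans κ f<ζ ζ≤ξ) (club-floor-upper C C-club ξ∈C (inj₁ ξ<α)) ,
              subst (_ <_) (sym (cf-b≡ α∈D)) σ<μ

  -- The successor property speaks of cardinals only, so `ρ` is replaced by the least `σ` whose
  -- segment is at least as large. That segment is a cardinal; were it strictly above `κ` in size,
  -- `κ⁺` would inject into its own segment.
  ↓-successor-≼ : (κ κ⁺ : Ordinal ℓ) → IsSuccessorCardinal κ κ⁺ → ∀ ρ → ∣ κ⁺ ↓ ρ ∣ ≼ ∣ κ ∣
  ↓-successor-≼ κ κ⁺ (κ⁺-cardinal , _ , κ⁺-least) ρ
    with least κ⁺ (λ σ → ∣ κ⁺ ↓ ρ ∣ ≼ ∣ κ⁺ ↓ σ ∣) (ρ , Subset-mono-≼ λ _ x<ρ → x<ρ)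
  ... | σ , ρ≼σ , σ-least with ≼-comparable κ ∣ κ⁺ ↓ σ ∣
  ...   | inj₂ (τ , σ≼τ) = Subset-≼ ↣-∘ (σ≼τ ↣-∘ ρ≼σ)
  ...   | inj₁ κ≼σ = byContradiction λ ρ⋠κ →
    κ⁺-cardinal σ (κ⁺-least (κ⁺ ↓ σ) σ-cardinal (κ≼σ , λ σ≼κ → ρ⋠κ (σ≼κ ↣-∘ ρ≼σ)))
    where
    σ-cardinal : IsCardinal (κ⁺ ↓ σ)
    σ-cardinal τ σ≼τ = <⇒≱ κ⁺ (member τ) (σ-least (value τ) (↓↓-≼ κ⁺ τ ↣-∘ (σ≼τ ↣-∘ ρ≼σ)))

lemma3p3 : (∀ {a} → ExcludedMiddle a) →
    (∀ {a b} → Extensionality a b) →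
    ∀ {ℓ} (κ : Ordinal ℓ) (let open Ordinal κ) →
    IsInaccessible κ →
    (b : ∣ κ ∣ → ∣ κ ∣) →
    Increasing κ b →
    (∀ α → IsInfiniteCardinal (κ ↓ b α)) →
    (∀ μ → IsRegular (κ ↓ μ) → Cofinal κ (D κ b μ) →
    (∀ ν → IsRegular (κ ↓ ν) → Cofinal κ (D κ b ν) → μ ≤ ν) →
    UnboundingNumberIs κ b (κ ↓ μ))
    ×
    ((∀ μ → IsRegular (κ ↓ μ) → Bounded κ (D κ b μ)) →
    (∃[ S ] IsStationary κ S ×
    (∀ ξ → S ξ → ∃[ α ] ξ ≤ α × (∃[ μ ] Cf-b κ b α μ × μ ≤ ξ))) →
    UnboundingNumberIs κ b κ)
    ×
    ((∀ μ → IsRegular (κ ↓ μ) → Bounded κ (D κ b μ)) →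
    (∃[ C ] IsClub κ {ℓ} C ×
    (∀ ξ → C ξ → ∀ α → ξ ≤ α → ∃[ μ ] Cf-b κ b α μ × ξ < μ)) →
    ∀ κ⁺ → IsSuccessorCardinal κ κ⁺ → UnboundingNumberAtLeast κ b κ⁺)
lemma3p3 em ext κ (κ-regular , κ-uncountable , _) b _ b-infinite =
  least-cofinal-D , stationary-small-cf ,
  λ _ C κ⁺ κ⁺-successor →
    ((λ _ → ⊤) , everything-unbounded) , λ A A-unbounded →
      -- Failing an injection of `κ⁺`, `A` fits into a proper segment of `κ⁺`, hence into `κ`, and
      -- is then bounded.
      [ (λ κ⁺≼A → κ⁺≼A)
      , (λ { (ρ , A≼ρ) → contradiction A-unbounded
               (club-large-cf C A (↓-successor-≼ κ κ⁺ κ⁺-successor ρ ↣-∘ A≼ρ)) })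
      ]′ (≼-comparable κ⁺ (Subset A))
  where
  open Classical em ext
  open BoundedProduct κ κ-regular κ-uncountable b b-infinite
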